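{- There is a $1/2$-approximation algorithm for unconstrained DR-submodular maximization with running time $O\left(n+\sum_{i\in E}\log B_i\right)$. That is, there is an algorithm that, given a finite set $E$ with $|E|=n$, positive integers $B_i$ ($i\in E$), and a DR-submodular function $f:\mathbb{Z}_+^E\to\mathbb{R}_+$, runs in time $O\left(n+\sum_{i\in E}\log B_i\right)$ and outputs a vector $\mathbf{x}\in\prod_{i\in E}\{0,1,\ldots,B_i\}$ whose value $f(\mathbf{x})$ is at least $\tfrac12\max\{f(\mathbf{z}):\mathbf{z}\in\prod_{i\in E}\{0,1,\ldots,B_i\}\}$.
   Context: $\mathbb{Z}_+$ and $\mathbb{R}_+$ denote the nonnegative integers and nonnegative reals. For $i\in E$, $\chi_i\in\{0,1\}^E$ is the vector with $1$ in coordinate $i$ and $0$ elsewhere; inequalities between vectors are coordinatewise. A function $f:\mathbb{Z}_+^E\to\mathbb{R}_+$ is DR-submodular if $f(\mathbf{x}+\chi_i)-f(\mathbf{x})\ge f(\mathbf{y}+\chi_i)-f(\mathbf{y})$ for all $\mathbf{x}\le\mathbf{y}$ in $\mathbb{Z}_+^E$ and all $i\in E$ ($f$ is not assumed monotone). Unconstrained DR-submodular maximization is the problem of maximizing such an $f$ over the box $\prod_{i\in E}\{0,1,\ldots,B_i\}$. The function $f$ is accessed through a value oracle; running time counts oracle calls and elementary arithmetic operations at unit cost. The algorithm may be randomized, in which case the approximation guarantee is for the expected value of $f$ at the output. -}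

module Defs where

open import Algebra.Structures using (IsCommutativeRing)
import Algebra.Construct.NaturalChoice.Max as Max
import Algebra.Construct.NaturalChoice.Min as Min
open import Data.Bool.Base using (Bool; true; false; if_then_else_)
open import Data.Fin.Base using (Fin; toℕ)
open import Data.List.Base using (List; []; _∷_; _++_)
open import Data.Nat.Base as ℕ using (ℕ; zero; suc)
open import Data.Nat.DivMod using (_/_)
open import Data.Nat.Logarithm using (⌊log₂_⌋)
open import Data.Product.Base using (∃; _×_; _,_; proj₁; proj₂)
open import Data.Vec.Base using (Vec; []; _∷_; _[_]≔_; replicate; zipWith; tabulate; map; sum)
open import Data.Vec.Relation.Binary.Pointwise.Inductive using (Pointwise)
open import Relation.Binary.Bundles using (DecTotalOrder)
open import Relation.Binary.PropositionalEquality.Core using (_≡_; _≢_)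
open import Relation.Binary.Structures using (IsDecTotalOrder)
open import Relation.Nullary.Decidable.Core using (⌊_⌋)

------------------------------------------------------------------------
-- The real numbers

-- A complete totally ordered field, which determines ℝ up to unique
-- isomorphism.  The order is decidable: ℝ is the classical real line and a
-- real RAM branches on comparisons of reals.  The value of 0# ⁻¹ is
-- unspecified.
record Reals : Set₁ where
  infix  8 _⁻¹ -_
  infixl 7 _*_
  infixl 6 _+_ _-_
  infix  4 _≤_
  field
    ℝ                 : Set
    _+_ _*_           : ℝ → ℝ → ℝ
    -_ _⁻¹            : ℝ → ℝ
    0# 1#             : ℝ
    _≤_               : ℝ → ℝ → Set
    isCommutativeRing : IsCommutativeRing _≡_ _+_ _*_ -_ 0# 1#
    0≢1               : 0# ≢ 1#
    *-inverseʳ        : ∀ x → x ≢ 0# → x * x ⁻¹ ≡ 1#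
    isDecTotalOrder   : IsDecTotalOrder _≡_ _≤_
    +-monoʳ-≤         : ∀ z {x y} → x ≤ y → z + x ≤ z + y
    *-nonNegative     : ∀ {x y} → 0# ≤ x → 0# ≤ y → 0# ≤ x * y

  UpperBound : (ℝ → Set) → ℝ → Set
  UpperBound P b = ∀ x → P x → x ≤ b

  field
    supremum : (P : ℝ → Set) → ∃ P → ∃ (UpperBound P) →
               ∃ λ s → UpperBound P s × (∀ b → UpperBound P b → s ≤ b)

  decTotalOrder : DecTotalOrder _ _ _
  decTotalOrder = record { isDecTotalOrder = isDecTotalOrder }

  open DecTotalOrder decTotalOrder public using (totalOrder; _≤?_)
  open Max totalOrder public using (_⊔_)
  open Min totalOrder public using (_⊓_)

  _-_ : ℝ → ℝ → ℝ
  x - y = x + (- y)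

  ½ : ℝ
  ½ = (1# + 1#) ⁻¹

  fromℕ : ℕ → ℝ
  fromℕ zero    = 0#
  fromℕ (suc k) = 1# + fromℕ k

------------------------------------------------------------------------
-- The integer lattice; the ground set E is Fin n

infix 4 _≤ᵛ_

_≤ᵛ_ : ∀ {n} → Vec ℕ n → Vec ℕ n → Set
_≤ᵛ_ = Pointwise ℕ._≤_

infixl 6 _+ᵛ_

_+ᵛ_ : ∀ {n} → Vec ℕ n → Vec ℕ n → Vec ℕ n
_+ᵛ_ = zipWith ℕ._+_

χ : ∀ {n} → Fin n → Vec ℕ n
χ i = replicate _ 0 [ i ]≔ 1

∑log₂ : ∀ {n} → Vec ℕ n → ℕ
∑log₂ B = sum (map ⌊log₂_⌋ B)

module Lattice (R : Reals) where
  open Reals R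

  NonNegative : ∀ {n} → (Vec ℕ n → ℝ) → Set
  NonNegative f = ∀ x → 0# ≤ f x

  DRSubmodular : ∀ {n} → (Vec ℕ n → ℝ) → Set
  DRSubmodular f = ∀ x y → x ≤ᵛ y → ∀ i →
    f (y +ᵛ χ i) - f y ≤ f (x +ᵛ χ i) - f x

  -- maximum of g 0 , … , g b
  maxUpTo : ℕ → (ℕ → ℝ) → ℝ
  maxUpTo zero    g = g 0
  maxUpTo (suc b) g = maxUpTo b g ⊔ g (suc b)

  -- maximum of f z over all z ≤ᵛ B
  maxBox : ∀ {n} → Vec ℕ n → (Vec ℕ n → ℝ) → ℝ
  maxBox []      f = f []
  maxBox (b ∷ B) f = maxUpTo b (λ k → maxBox B (λ z → f (k ∷ z)))

------------------------------------------------------------------------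
-- Programs for a randomized real RAM with a value oracle

-- There are registers and indirectly addressed memory cells, both in an
-- integer version (holding naturals) and a real version.  Every instruction
-- performs a single elementary operation, so its cost is 1.

Reg : Set
Reg = ℕ

data ℕOp : Set where
  add sub mul div : ℕOp

data ℝOp : Set where
  add sub mul div : ℝOp

data Test : Set where
  _≤ⁿ_ _<ⁿ_ : Reg → Reg → Test   -- integer registers
  _≤ʳ_      : Reg → Reg → Test   -- real registers

data Instr : Set where
  const         : (d : Reg) (k : ℕ) → Instr
  ℕ-op          : ℕOp → (d a b : Reg) → Instr
  load store    : (d a : Reg) → Instr            -- second register: address
  toReal        : (d a : Reg) → Instr
  ℝ-op          : ℝOp → (d a b : Reg) → Instr
  loadʳ storeʳ  : (d a : Reg) → Instr            -- second register: address
  query         : (d a : Reg) → Instr            -- oracle call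
  flip          : (d p : Reg) → Instr            -- biased coin
  branch        : Test → (yes no : List Instr) → Instr
  while         : Test → (body : List Instr) → Instr

Program : Set
Program = List Instr

⟦_⟧ⁿ : ℕOp → ℕ → ℕ → ℕ
⟦ add ⟧ⁿ a b       = a ℕ.+ b
⟦ sub ⟧ⁿ a b       = a ℕ.∸ b
⟦ mul ⟧ⁿ a b       = a ℕ.* b
⟦ div ⟧ⁿ a zero    = 0
⟦ div ⟧ⁿ a (suc b) = a / suc b

infixl 9 _[_↦_]

_[_↦_] : {A : Set} → (ℕ → A) → ℕ → A → (ℕ → A)
(m [ i ↦ v ]) j = if i ℕ.≡ᵇ j then v else m j

-- An input vector as memory contents, padded with zeros.
contents : ∀ {n} → Vec ℕ n → ℕ → ℕ
contents []      _       = 0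
contents (b ∷ B) zero    = b
contents (b ∷ B) (suc a) = contents B a

------------------------------------------------------------------------
-- Finite probability trees

module Probability (R : Reals) where
  open Reals R

  -- coin p μ ν continues as μ with probability p, as ν with probability
  -- 1 - p.  The machine below only builds trees with 0 ≤ p ≤ 1.
  data Dist (A : Set) : Set where
    pure : A → Dist A
    coin : ℝ → Dist A → Dist A → Dist A

  infixl 1 _>>=_

  _>>=_ : {A B : Set} → Dist A → (A → Dist B) → Dist B
  pure a     >>= k = k a
  coin p μ ν >>= k = coin p (μ >>= k) (ν >>= k)

  𝔼 : {A : Set} → (A → ℝ) → Dist A → ℝ
  𝔼 g (pure a)     = g a
  𝔼 g (coin p μ ν) = p * 𝔼 g μ + (1# - p) * 𝔼 g ν

  AllOutcomes : {A : Set} → (A → Set) → Dist A → Set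
  AllOutcomes P (pure a)     = P a
  AllOutcomes P (coin p μ ν) = AllOutcomes P μ × AllOutcomes P ν

------------------------------------------------------------------------
-- Execution

module Machine (R : Reals) where
  open Reals R
  open Probability R

  record State : Set where
    constructor state
    field
      reg  : ℕ → ℕ
      mem  : ℕ → ℕ
      regʳ : ℕ → ℝ
      memʳ : ℕ → ℝ

  open State public

  -- The instructions still to be executed, and the current state.
  Config : Set
  Config = List Instr × State

  Halted : Config → Set
  Halted c = proj₁ c ≡ []

  ⟦_⟧ʳ : ℝOp → ℝ → ℝ → ℝ
  ⟦ add ⟧ʳ x y = x + y
  ⟦ sub ⟧ʳ x y = x - y
  ⟦ mul ⟧ʳ x y = x * y
  ⟦ div ⟧ʳ x y = x * y ⁻¹

  test : Test → State → Bool
  test (a ≤ⁿ b) s = reg s a ℕ.≤ᵇ reg s b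
  test (a <ⁿ b) s = reg s a ℕ.<ᵇ reg s b
  test (a ≤ʳ b) s = ⌊ regʳ s a ≤? regʳ s b ⌋

  -- The vector in the n consecutive memory cells starting at address a.
  vectorAt : ∀ {n} → State → ℕ → Vec ℕ n
  vectorAt s a = tabulate (λ i → mem s (a ℕ.+ toℕ i))

  setReg : Reg → ℕ → State → State
  setReg d v s = record s { reg = reg s [ d ↦ v ] }

  setRegʳ : Reg → ℝ → State → State
  setRegʳ d v s = record s { regʳ = regʳ s [ d ↦ v ] }

  -- coins always have a bias in [0,1]
  clamp : ℝ → ℝ
  clamp p = 0# ⊔ (p ⊓ 1#)

  step : ∀ {n} → (Vec ℕ n → ℝ) → Config → Dist Config
  step f ([] , s)               = pure ([] , s)
  step f (const d k ∷ K , s)    = pure (K , setReg d k s)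
  step f (ℕ-op o d a b ∷ K , s) = pure (K , setReg d (⟦ o ⟧ⁿ (reg s a) (reg s b)) s)
  step f (load d a ∷ K , s)     = pure (K , setReg d (mem s (reg s a)) s)
  step f (store d a ∷ K , s)    = pure (K , record s { mem = mem s [ reg s a ↦ reg s d ] })
  step f (toReal d a ∷ K , s)   = pure (K , setRegʳ d (fromℕ (reg s a)) s)
  step f (ℝ-op o d a b ∷ K , s) = pure (K , setRegʳ d (⟦ o ⟧ʳ (regʳ s a) (regʳ s b)) s)
  step f (loadʳ d a ∷ K , s)    = pure (K , setRegʳ d (memʳ s (reg s a)) s)
  step f (storeʳ d a ∷ K , s)   = pure (K , record s { memʳ = memʳ s [ reg s a ↦ regʳ s d ] })
  step f (query d a ∷ K , s)    = pure (K , setRegʳ d (f (vectorAt s (reg s a))) s)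
  step f (flip d p ∷ K , s)     =
    coin (clamp (regʳ s p)) (pure (K , setReg d 1 s)) (pure (K , setReg d 0 s))
  step f (branch t P Q ∷ K , s) = pure ((if test t s then P else Q) ++ K , s)
  step f (while t P ∷ K , s)    =
    pure ((if test t s then P ++ while t P ∷ K else K) , s)

  -- The distribution of configurations after t steps.
  run : ∀ {n} → (Vec ℕ n → ℝ) → (t : ℕ) → Config → Dist Config
  run f zero    c = pure c
  run f (suc t) c = step f c >>= run f t

  -- Initially integer register 0 holds n, the integer memory cells
  -- 0 , … , n ∸ 1 hold B, and everything else is 0.
  start : ∀ {n} → Program → Vec ℕ n → Config
  start {n} P B = P , record
    { reg  = (λ _ → 0) [ 0 ↦ n ]
    ; mem  = contents B
    ; regʳ = λ _ → 0#
    ; memʳ = λ _ → 0#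
    }

  -- At the end integer register 0 holds the address of the output vector.
  output : ∀ {n} → Config → Vec ℕ n
  output (_ , s) = vectorAt s (reg s 0)

{-# OPTIONS --safe #-}
module Submission where

-- Each coordinate i keeps an interval [xᵢ , yᵢ], initially [0 , Bᵢ], which is
-- split into halves of lengths w ≥ h.  The randomized double greedy algorithm
-- chooses between x + w χᵢ and y − w χᵢ with probabilities proportional to
-- their gains, so that the interval shrinks to length h and 1 + ⌊log₂ Bᵢ⌋
-- choices settle coordinate i.  Any value in [xᵢ , yᵢ] is reached by such
-- choices because w ≤ h + 1.  With o an optimal solution that is moved into
-- [x , y] after each choice, f x + f y + 2 f o does not decrease in
-- expectation: by the DR property the loss of f o is at most the gain of the
-- rejected choice, and 2 a b ≤ a² + b².  At the end x = o = y.

open import Defs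
open import Algebra.Bundles using (CommutativeRing)
import Algebra.Construct.NaturalChoice.Max as Max
import Algebra.Construct.NaturalChoice.Min as Min
import Algebra.Properties.AbelianGroup as AbelianGroupProperties
import Algebra.Properties.Ring as RingProperties
import Algebra.Solver.Ring.NaturalCoefficients.Default as SemiringSolver
open import Data.Bool.Base using (Bool; true; false; T; not)
open import Data.Bool.ListAction using (all)
open import Data.Bool.Properties using (T-∧)
open import Data.Fin.Base using (Fin; zero; suc; toℕ; fromℕ<)
import Data.Fin.Properties as Fin
open import Data.List.Base using (List; []; _∷_; _++_; length)
open import Data.Nat.Base as ℕ using (ℕ; zero; suc)
open import Data.Nat.DivMod using (_/_; _%_; m≡m%n+[m/n]*n; m%n<n; m/n≤m; m/n*n≤m)
open import Data.Nat.Logarithm using (⌊log₂_⌋; ⌊log₂⌋-mono-≤; ⌊log₂[2*b]⌋≡1+⌊log₂b⌋)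
import Data.Nat.Properties as ℕ
open import Data.Nat.Tactic.RingSolver using (solve-∀)
open import Data.Product.Base using (∃; ∃₂; Σ-syntax; _×_; _,_; proj₁; proj₂)
open import Data.Sum.Base using (inj₁; inj₂)
open import Data.Unit.Base using (tt)
open import Data.Vec.Base using (Vec; []; _∷_; _[_]≔_; replicate; zipWith; tabulate; sum; lookup)
open import Data.Vec.Properties
  using ( []≔-lookup; []≔-idempotent; lookup∘update; lookup∘update′; lookup∘tabulate
        ; tabulate∘lookup; tabulate-cong; lookup-replicate; zipWith-identityʳ)
open import Data.Vec.Relation.Binary.Pointwise.Inductive as Pointwise using ([]; _∷_)
open import Data.Vec.Relation.Unary.All using (All; []; _∷_)
open import Function.Base using (_∘_)
open import Function.Bundles using (Equivalence)
open import Relation.Binary.Bundles using (DecTotalOrder)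
open import Relation.Binary.PropositionalEquality
  using (_≡_; _≢_; refl; sym; trans; cong; cong₂; subst; subst₂; ≢-sym; module ≡-Reasoning)
import Relation.Binary.Reasoning.PartialOrder as PartialOrderReasoning
open import Relation.Nullary using (¬_; yes; no; contradiction)
open import Relation.Nullary.Decidable.Core using (toWitness; toWitnessFalse)

-- Arithmetic in an ordered field.

module OrderedField (R : Reals) where
  open Reals R
  open DecTotalOrder decTotalOrder
    using (poset; total)
    renaming (refl to ≤-refl; reflexive to ≤-reflexive; trans to ≤-trans; antisym to ≤-antisym) public

  commutativeRing : CommutativeRing _ _
  commutativeRing = record { isCommutativeRing = isCommutativeRing }

  open CommutativeRing commutativeRing public
    using ( ring; +-abelianGroup; commutativeSemiring; +-comm; *-comm; +-identityˡ; +-identityʳ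
          ; *-identityˡ; -‿inverseʳ; +-assoc; *-assoc; distribˡ)
  open RingProperties ring using (-‿distribˡ-*; -‿distribʳ-*; -‿involutive; ⁻¹-anti-homo-//)
  open AbelianGroupProperties +-abelianGroup using (xyx⁻¹≈y)
  open SemiringSolver commutativeSemiring using (solve; _:+_; _:*_; _:=_; con) public
  module ≤-Reasoning = PartialOrderReasoning poset hiding (start)

  +-monoˡ-≤ : ∀ z {x y} → x ≤ y → x + z ≤ y + z
  +-monoˡ-≤ z {x} {y} x≤y = subst₂ _≤_ (+-comm z x) (+-comm z y) (+-monoʳ-≤ z x≤y)

  +-mono-≤ : ∀ {x y u v} → x ≤ y → u ≤ v → x + u ≤ y + v
  +-mono-≤ {y = y} {u} x≤y u≤v = ≤-trans (+-monoˡ-≤ u x≤y) (+-monoʳ-≤ y u≤v)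

  +-nonNegative : ∀ {x y} → 0# ≤ x → 0# ≤ y → 0# ≤ x + y
  +-nonNegative {x} {y} 0≤x 0≤y = subst (_≤ x + y) (+-identityˡ 0#) (+-mono-≤ 0≤x 0≤y)

  x+[y-x]≡y : ∀ x y → x + (y - x) ≡ y
  x+[y-x]≡y x y = trans (sym (+-assoc x y (- x))) (xyx⁻¹≈y x y)

  x-y≤z⇒x≤y+z : ∀ {x y z} → x - y ≤ z → x ≤ y + z
  x-y≤z⇒x≤y+z {x} {y} {z} x-y≤z = subst (_≤ y + z) (x+[y-x]≡y y x) (+-monoʳ-≤ y x-y≤z)

  x≤y⇒0≤y-x : ∀ {x y} → x ≤ y → 0# ≤ y - x
  x≤y⇒0≤y-x {x} {y} x≤y = subst (_≤ y - x) (-‿inverseʳ x) (+-monoˡ-≤ (- x) x≤y)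

  *-monoʳ-≤ : ∀ {z} → 0# ≤ z → ∀ {x y} → x ≤ y → z * x ≤ z * y
  *-monoʳ-≤ {z} 0≤z {x} {y} x≤y = begin
    z * x                ≡⟨ +-identityʳ (z * x) ⟨
    z * x + 0#           ≤⟨ +-monoʳ-≤ (z * x) (*-nonNegative 0≤z (x≤y⇒0≤y-x x≤y)) ⟩
    z * x + z * (y - x)  ≡⟨ distribˡ z x (y - x) ⟨
    z * (x + (y - x))    ≡⟨ cong (z *_) (x+[y-x]≡y x y) ⟩
    z * y                ∎
    where open ≤-Reasoning

  x≤0⇒0≤-x : ∀ {x} → x ≤ 0# → 0# ≤ - x
  x≤0⇒0≤-x {x} x≤0 = subst (0# ≤_) (+-identityˡ (- x)) (x≤y⇒0≤y-x x≤0)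

  square-nonNegative : ∀ x → 0# ≤ x * x
  square-nonNegative x with total 0# x
  ... | inj₁ 0≤x = *-nonNegative 0≤x 0≤x
  ... | inj₂ x≤0 = subst (0# ≤_) -x*-x≡x*x (*-nonNegative (x≤0⇒0≤-x x≤0) (x≤0⇒0≤-x x≤0))
    where
    open ≡-Reasoning
    -x*-x≡x*x : - x * - x ≡ x * x
    -x*-x≡x*x = begin
      - x * - x      ≡⟨ -‿distribˡ-* x (- x) ⟨
      - (x * - x)    ≡⟨ cong -_ (-‿distribʳ-* x x) ⟨
      - - (x * x)    ≡⟨ -‿involutive (x * x) ⟩
      x * x          ∎

  0≤1 : 0# ≤ 1#
  0≤1 = subst (0# ≤_) (*-identityˡ 1#) (square-nonNegative 1#)

  -- The inverse equals `x` times the square of the inverse, a product of nonnegative factors.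
  ⁻¹-nonNegative : ∀ {x} → 0# ≤ x → x ≢ 0# → 0# ≤ x ⁻¹
  ⁻¹-nonNegative {x} 0≤x x≢0 = subst (0# ≤_) x*[x⁻¹*x⁻¹]≡x⁻¹ (*-nonNegative 0≤x (square-nonNegative (x ⁻¹)))
    where
    x*[x⁻¹*x⁻¹]≡x⁻¹ : x * (x ⁻¹ * x ⁻¹) ≡ x ⁻¹
    x*[x⁻¹*x⁻¹]≡x⁻¹ = trans (sym (*-assoc x (x ⁻¹) (x ⁻¹)))
      (trans (cong (_* x ⁻¹) (*-inverseʳ x x≢0)) (*-identityˡ (x ⁻¹)))

  1+1≢0 : 1# + 1# ≢ 0#
  1+1≢0 1+1≡0 = 0≢1 (≤-antisym 0≤1 (subst₂ _≤_ (+-identityʳ 1#) 1+1≡0 (+-monoʳ-≤ 1# 0≤1)))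

  ½*[x+x]≡x : ∀ x → ½ * (x + x) ≡ x
  ½*[x+x]≡x x = begin
    ½ * (x + x)        ≡⟨ solve 2 (λ h x → h :* (x :+ x) := ((con 1 :+ con 1) :* h) :* x) refl ½ x ⟩
    (1# + 1#) * ½ * x  ≡⟨ cong (_* x) (*-inverseʳ (1# + 1#) 1+1≢0) ⟩
    1# * x             ≡⟨ *-identityˡ x ⟩
    x                  ∎
    where open ≡-Reasoning

  x≤y+y⇒½*x≤y : ∀ {x y} → x ≤ y + y → ½ * x ≤ y
  x≤y+y⇒½*x≤y {x} {y} x≤y+y = subst (½ * x ≤_) (½*[x+x]≡x y)
    (*-monoʳ-≤ (⁻¹-nonNegative (+-nonNegative 0≤1 0≤1) 1+1≢0) x≤y+y)

  -- Balanced coins.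

  -- The condition on a coin under which the potential of the double greedy
  -- algorithm does not decrease in expectation, for gains a and b.
  record Balanced (a b p q : ℝ) : Set where
    field
      p+q≡1 : p + q ≡ 1#
      0≤p   : 0# ≤ p
      0≤q   : 0# ≤ q
      2qa≤  : q * a + q * a ≤ p * a + q * b
      2pb≤  : p * b + p * b ≤ p * a + q * b

  balanced-sym : ∀ {a b p q} → Balanced a b p q → Balanced b a q p
  balanced-sym {a} {b} {p} {q} bal = record
    { p+q≡1 = trans (+-comm q p) p+q≡1
    ; 0≤p   = 0≤q
    ; 0≤q   = 0≤p
    ; 2qa≤  = subst (p * b + p * b ≤_) (+-comm (p * a) (q * b)) 2pb≤
    ; 2pb≤  = subst (q * a + q * a ≤_) (+-comm (p * a) (q * b)) 2qa≤
    }
    where open Balanced bal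

  -- As `b` is nonpositive and `a + b` is not negative, `a` is nonnegative and dominates both
  -- losses, which are zero and `b + b`.
  balanced-one : ∀ {a b} → 0# ≤ a + b → b ≤ 0# → Balanced a b 1# 0#
  balanced-one {a} {b} 0≤a+b b≤0 = record
    { p+q≡1 = +-identityʳ 1#
    ; 0≤p   = 0≤1
    ; 0≤q   = ≤-refl
    ; 2qa≤  = begin
        0# * a + 0# * a  ≡⟨ solve 1 (λ a → con 0 :* a :+ con 0 :* a := con 0) refl a ⟩
        0#               ≤⟨ 0≤a ⟩
        a                ≡⟨ gain ⟨
        1# * a + 0# * b  ∎
    ; 2pb≤  = begin
        1# * b + 1# * b  ≡⟨ solve 1 (λ b → con 1 :* b :+ con 1 :* b := b :+ b) refl b ⟩
        b + b            ≤⟨ +-mono-≤ b≤0 b≤0 ⟩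
        0# + 0#          ≡⟨ +-identityˡ 0# ⟩
        0#               ≤⟨ 0≤a ⟩
        a                ≡⟨ gain ⟨
        1# * a + 0# * b  ∎
    }
    where
    open ≤-Reasoning
    0≤a : 0# ≤ a
    0≤a = ≤-trans 0≤a+b (subst (a + b ≤_) (+-identityʳ a) (+-monoʳ-≤ a b≤0))
    gain : 1# * a + 0# * b ≡ a
    gain = solve 2 (λ a b → con 1 :* a :+ con 0 :* b := a) refl a b

  balanced-zero : ∀ {a b} → 0# ≤ a + b → a ≤ 0# → Balanced a b 0# 1#
  balanced-zero {a} {b} 0≤a+b a≤0 = balanced-sym (balanced-one (subst (0# ≤_) (+-comm a b) 0≤a+b) a≤0)

  -- With `b` written as `a + c` the two sides differ by the square of `c`. The substitution removes
  -- subtraction, so that a semiring identity suffices.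
  2ab≤a²+b² : ∀ a b → a * b + a * b ≤ a * a + b * b
  2ab≤a²+b² a b = begin
    a * b + a * b                                ≡⟨ cong (λ b → a * b + a * b) b≡a+c ⟩
    a * (a + c) + a * (a + c)                    ≡⟨ +-identityʳ _ ⟨
    a * (a + c) + a * (a + c) + 0#               ≤⟨ +-monoʳ-≤ _ (square-nonNegative c) ⟩
    a * (a + c) + a * (a + c) + c * c            ≡⟨ solve 2 (λ a c → a :* (a :+ c) :+ a :* (a :+ c) :+ c :* c
                                                      := a :* a :+ (a :+ c) :* (a :+ c)) refl a c ⟩
    a * a + (a + c) * (a + c)                    ≡⟨ cong (λ b → a * a + b * b) b≡a+c ⟨
    a * a + b * b                                ∎
    where
    open ≤-Reasoning
    c = b - a
    b≡a+c : b ≡ a + c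
    b≡a+c = sym (x+[y-x]≡y a b)

  -- With probabilities proportional to the gains, both doubled losses become `2ab / (a + b)`, while
  -- the expected gain is `(a² + b²) / (a + b)`.
  balanced-ratio : ∀ {a b} → 0# ≤ a → 0# ≤ b → a + b ≢ 0# →
                   Balanced a b (a * (a + b) ⁻¹) (b * (a + b) ⁻¹)
  balanced-ratio {a} {b} 0≤a 0≤b a+b≢0 = record
    { p+q≡1 = trans (solve 3 (λ a b r → a :* r :+ b :* r := (a :+ b) :* r) refl a b r)
                    (*-inverseʳ (a + b) a+b≢0)
    ; 0≤p   = *-nonNegative 0≤a 0≤r
    ; 0≤q   = *-nonNegative 0≤b 0≤r
    ; 2qa≤  = begin
        b * r * a + b * r * a  ≡⟨ solve 3 (λ a b r → b :* r :* a :+ b :* r :* a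
                                    := r :* (a :* b :+ a :* b)) refl a b r ⟩
        r * (a * b + a * b)    ≤⟨ loss≤gain ⟩
        a * r * a + b * r * b  ∎
    ; 2pb≤  = begin
        a * r * b + a * r * b  ≡⟨ solve 3 (λ a b r → a :* r :* b :+ a :* r :* b
                                    := r :* (a :* b :+ a :* b)) refl a b r ⟩
        r * (a * b + a * b)    ≤⟨ loss≤gain ⟩
        a * r * a + b * r * b  ∎
    }
    where
    open ≤-Reasoning
    r = (a + b) ⁻¹
    0≤r : 0# ≤ r
    0≤r = ⁻¹-nonNegative (+-nonNegative 0≤a 0≤b) a+b≢0
    loss≤gain : r * (a * b + a * b) ≤ a * r * a + b * r * b
    loss≤gain = begin
      r * (a * b + a * b)    ≤⟨ *-monoʳ-≤ 0≤r (2ab≤a²+b² a b) ⟩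
      r * (a * a + b * b)    ≡⟨ solve 3 (λ a b r → r :* (a :* a :+ b :* b)
                                  := a :* r :* a :+ b :* r :* b) refl a b r ⟩
      a * r * a + b * r * b  ∎

  -- Here `o` survives the first move and becomes `o′` under the second, which has probability `q`.
  -- Its doubled loss is at most `q * a + q * a` in expectation, and `2qa≤` pays for that with the
  -- expected gain.
  coin-potential : ∀ {a b p q} → Balanced a b p q → ∀ {o o′} → o ≤ o′ + a → ∀ X Y →
    (X + Y) + (o + o) ≤ p * (((X + a) + Y) + (o + o)) + q * ((X + (Y + b)) + (o′ + o′))
  coin-potential {a} {b} {p} {q} bal {o} {o′} o≤o′+a X Y = begin
    (X + Y) + (o + o)
      ≡⟨ *-identityˡ _ ⟨
    1# * ((X + Y) + (o + o))
      ≡⟨ cong (_* ((X + Y) + (o + o))) p+q≡1 ⟨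
    (p + q) * ((X + Y) + (o + o))
      ≡⟨ solve 5 (λ p q X Y o → (p :+ q) :* ((X :+ Y) :+ (o :+ o)) :=
           ((p :+ q) :* (X :+ Y) :+ p :* (o :+ o)) :+ q :* (o :+ o)) refl p q X Y o ⟩
    S + q * (o + o)
      ≤⟨ +-monoʳ-≤ S (*-monoʳ-≤ 0≤q (+-mono-≤ o≤o′+a o≤o′+a)) ⟩
    S + q * ((o′ + a) + (o′ + a))
      ≡⟨ solve 4 (λ S q a o′ → S :+ q :* ((o′ :+ a) :+ (o′ :+ a)) :=
           (S :+ q :* (o′ :+ o′)) :+ (q :* a :+ q :* a)) refl S q a o′ ⟩
    (S + q * (o′ + o′)) + (q * a + q * a)
      ≤⟨ +-monoʳ-≤ _ 2qa≤ ⟩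
    (S + q * (o′ + o′)) + (p * a + q * b)
      ≡⟨ solve 8 (λ p q X Y o o′ a b →
           (((p :+ q) :* (X :+ Y) :+ p :* (o :+ o)) :+ q :* (o′ :+ o′)) :+ (p :* a :+ q :* b) :=
           p :* (((X :+ a) :+ Y) :+ (o :+ o)) :+ q :* ((X :+ (Y :+ b)) :+ (o′ :+ o′)))
           refl p q X Y o o′ a b ⟩
    p * (((X + a) + Y) + (o + o)) + q * ((X + (Y + b)) + (o′ + o′))  ∎
    where
    open Balanced bal
    open ≤-Reasoning
    S = (p + q) * (X + Y) + p * (o + o)

  -- The mirror case, in which `o` survives the second move, follows by exchanging the two moves.
  coin-potential-sym : ∀ {a b p q} → Balanced a b p q → ∀ {o o′} → o ≤ o′ + b → ∀ X Y →
    (X + Y) + (o + o) ≤ p * (((X + a) + Y) + (o′ + o′)) + q * ((X + (Y + b)) + (o + o))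
  coin-potential-sym {a} {b} {p} {q} bal {o} {o′} o≤o′+b X Y = subst₂ _≤_
    (cong (_+ (o + o)) (+-comm Y X))
    (solve 8 (λ p q X Y o o′ a b →
       q :* (((Y :+ b) :+ X) :+ (o :+ o)) :+ p :* ((Y :+ (X :+ a)) :+ (o′ :+ o′)) :=
       p :* (((X :+ a) :+ Y) :+ (o′ :+ o′)) :+ q :* ((X :+ (Y :+ b)) :+ (o :+ o)))
       refl p q X Y o o′ a b)
    (coin-potential (balanced-sym bal) o≤o′+b Y X)

  module _ {a b p q : ℝ} (bal : Balanced a b p q) where
    open Balanced bal

    balanced⇒p≤1 : p ≤ 1#
    balanced⇒p≤1 = subst₂ _≤_ (+-identityʳ p) p+q≡1 (+-monoʳ-≤ p 0≤q)

    balanced⇒1-p≡q : 1# - p ≡ q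
    balanced⇒1-p≡q = trans (cong (_- p) (sym p+q≡1)) (xyx⁻¹≈y p q)

  0≤x-y+z : ∀ {x y z} → x - y ≤ z → 0# ≤ z + (y - x)
  0≤x-y+z {x} {y} {z} x-y≤z = subst (λ w → 0# ≤ z + w) (⁻¹-anti-homo-// x y) (x≤y⇒0≤y-x x-y≤z)

-- Order and single-entry updates on integer vectors.

≤ᵛ-refl : ∀ {n} {x : Vec ℕ n} → x ≤ᵛ x
≤ᵛ-refl = Pointwise.refl ℕ.≤-refl

≤ᵛ-trans : ∀ {n} {x y z : Vec ℕ n} → x ≤ᵛ y → y ≤ᵛ z → x ≤ᵛ z
≤ᵛ-trans = Pointwise.trans ℕ.≤-trans

≤ᵛ-antisym : ∀ {n} {x y : Vec ℕ n} → x ≤ᵛ y → y ≤ᵛ x → x ≡ y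
≤ᵛ-antisym []        []        = refl
≤ᵛ-antisym (p ∷ x≤y) (q ∷ y≤x) = cong₂ _∷_ (ℕ.≤-antisym p q) (≤ᵛ-antisym x≤y y≤x)

0≤ᵛ : ∀ {n} (x : Vec ℕ n) → replicate n 0 ≤ᵛ x
0≤ᵛ []      = []
0≤ᵛ (_ ∷ x) = ℕ.z≤n ∷ 0≤ᵛ x

[]≔-mono-≤ : ∀ {n} (i : Fin n) {x y : Vec ℕ n} {u v} → x ≤ᵛ y → u ℕ.≤ v → x [ i ]≔ u ≤ᵛ y [ i ]≔ v
[]≔-mono-≤ zero    (_ ∷ x≤y) u≤v = u≤v ∷ x≤y
[]≔-mono-≤ (suc i) (p ∷ x≤y) u≤v = p ∷ []≔-mono-≤ i x≤y u≤v

[]≔-≤ : ∀ {n} (i : Fin n) {x y : Vec ℕ n} {u} → x ≤ᵛ y → u ℕ.≤ lookup y i → x [ i ]≔ u ≤ᵛ y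
[]≔-≤ i {y = y} x≤y u≤yᵢ = subst (_ ≤ᵛ_) ([]≔-lookup y i) ([]≔-mono-≤ i x≤y u≤yᵢ)

≤-[]≔ : ∀ {n} (i : Fin n) {x y : Vec ℕ n} {v} → x ≤ᵛ y → lookup x i ℕ.≤ v → x ≤ᵛ y [ i ]≔ v
≤-[]≔ i {x = x} x≤y xᵢ≤v = subst (_≤ᵛ _) ([]≔-lookup x i) ([]≔-mono-≤ i x≤y xᵢ≤v)

lookup-injective : ∀ {A : Set} {n} {x y : Vec A n} → (∀ i → lookup x i ≡ lookup y i) → x ≡ y
lookup-injective {x = x} {y} eq =
  trans (sym (tabulate∘lookup x)) (trans (tabulate-cong eq) (tabulate∘lookup y))

+ᵛ-χ : ∀ {n} (i : Fin n) (x : Vec ℕ n) {u} → (x [ i ]≔ u) +ᵛ χ i ≡ x [ i ]≔ suc u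
+ᵛ-χ zero    (_ ∷ x) {u} = cong₂ _∷_ (ℕ.+-comm u 1) (zipWith-identityʳ ℕ.+-identityʳ x)
+ᵛ-χ (suc i) (a ∷ x)     = cong₂ _∷_ (ℕ.+-identityʳ a) (+ᵛ-χ i x)

-- Both vectors are updated so that one statement serves raising `x` as well as lowering `y`; the
-- other update then writes back the old entry.
sum-zipWith-[]≔ : ∀ {n} (g : ℕ → ℕ → ℕ) (i : Fin n) (y x : Vec ℕ n) {v u} →
  g v u ℕ.< g (lookup y i) (lookup x i) →
  sum (zipWith g (y [ i ]≔ v) (x [ i ]≔ u)) ℕ.< sum (zipWith g y x)
sum-zipWith-[]≔ g zero    (_ ∷ y) (_ ∷ x) lt = ℕ.+-monoˡ-< _ lt
sum-zipWith-[]≔ g (suc i) (_ ∷ y) (_ ∷ x) lt = ℕ.+-monoʳ-< _ (sum-zipWith-[]≔ g i y x lt)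

-- Halving intervals.

-- For v > u this is 1 + ⌊log₂ (v ∸ u)⌋, and 0 otherwise: the number of times
-- that the interval [u , v] can be halved.
halvings : ℕ → ℕ → ℕ
halvings v u = ⌊log₂ (2 ℕ.* (v ℕ.∸ u)) ⌋

totalHalvings : ∀ {n} → Vec ℕ n → Vec ℕ n → ℕ
totalHalvings y x = sum (zipWith halvings y x)

-- Each positive bound contributes one plus its logarithm; this is the source of `n + ∑log₂ B` in
-- the running time.
totalHalvings-initial : ∀ {n} {B : Vec ℕ n} → All (0 ℕ.<_) B →
                        totalHalvings B (replicate n 0) ≡ n ℕ.+ ∑log₂ B
totalHalvings-initial []                           = refl
totalHalvings-initial {suc n} {B = b ∷ B} (0<b ∷ 0<B) = begin
  halvings b 0 ℕ.+ totalHalvings B (replicate n 0)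
    ≡⟨ cong₂ ℕ._+_ (⌊log₂[2*b]⌋≡1+⌊log₂b⌋ b {{ℕ.>-nonZero 0<b}}) (totalHalvings-initial 0<B) ⟩
  (1 ℕ.+ ⌊log₂ b ⌋) ℕ.+ (n ℕ.+ ∑log₂ B)
    ≡⟨ shuffle ⌊log₂ b ⌋ n (∑log₂ B) ⟩
  suc n ℕ.+ (⌊log₂ b ⌋ ℕ.+ ∑log₂ B)
    ∎
  where
  open ≡-Reasoning
  shuffle : ∀ l m s → (1 ℕ.+ l) ℕ.+ (m ℕ.+ s) ≡ suc m ℕ.+ (l ℕ.+ s)
  shuffle = solve-∀

-- `w` is half of `d` rounded up, `h` half rounded down. By the last field, a value below the raised
-- lower end is at most the lowered upper end.
record Halves (d w h : ℕ) : Set where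
  field
    w+h≡d : w ℕ.+ h ≡ d
    h≤w   : h ℕ.≤ w
    w≤1+h : w ℕ.≤ suc h

halves : ∀ d → Halves d (d ℕ.∸ d / 2) (d / 2)
halves d = record
  { w+h≡d = ℕ.m∸n+n≡m (m/n≤m d 2)
  ; h≤w   = ℕ.m+n≤o⇒m≤o∸n (d / 2) (subst (ℕ._≤ d) (double (d / 2)) (m/n*n≤m d 2))
  ; w≤1+h = ℕ.m≤n+o⇒m∸n≤o d (d / 2) (begin
      d                        ≡⟨ m≡m%n+[m/n]*n d 2 ⟩
      d % 2 ℕ.+ d / 2 ℕ.* 2    ≤⟨ ℕ.+-monoˡ-≤ (d / 2 ℕ.* 2) (ℕ.s≤s⁻¹ (m%n<n d 2)) ⟩
      1 ℕ.+ d / 2 ℕ.* 2        ≡⟨ odd (d / 2) ⟩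
      d / 2 ℕ.+ suc (d / 2)    ∎)
  }
  where
  open ℕ.≤-Reasoning
  double : ∀ h → h ℕ.* 2 ≡ h ℕ.+ h
  double = solve-∀
  odd : ∀ h → 1 ℕ.+ h ℕ.* 2 ≡ h ℕ.+ suc h
  odd = solve-∀

-- Since `h` is at most `w`, twice `h` is at most `d`, whose logarithm is one less than that of
-- `2 * d` when `d` is positive.
halves-< : ∀ {d w h} → 0 ℕ.< d → Halves d w h → ⌊log₂ (2 ℕ.* h) ⌋ ℕ.< ⌊log₂ (2 ℕ.* d) ⌋
halves-< {d} {w} {h} 0<d hv = begin
  suc ⌊log₂ (2 ℕ.* h) ⌋  ≤⟨ ℕ.s≤s (⌊log₂⌋-mono-≤ 2h≤d) ⟩
  suc ⌊log₂ d ⌋          ≡⟨ ⌊log₂[2*b]⌋≡1+⌊log₂b⌋ d {{ℕ.>-nonZero 0<d}} ⟨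
  ⌊log₂ (2 ℕ.* d) ⌋      ∎
  where
  open Halves hv
  open ℕ.≤-Reasoning
  2h≤d : 2 ℕ.* h ℕ.≤ d
  2h≤d = begin
    h ℕ.+ (h ℕ.+ 0)  ≡⟨ cong (h ℕ.+_) (ℕ.+-identityʳ h) ⟩
    h ℕ.+ h          ≤⟨ ℕ.+-monoˡ-≤ h h≤w ⟩
    w ℕ.+ h          ≡⟨ w+h≡d ⟩
    d                ∎

-- The potential of double greedy.

module DoubleGreedy (R : Reals) where
  open Reals R
  open Lattice R
  open OrderedField R
  open Max totalOrder using (⊔-sel)

  maxUpTo-attained : ∀ b (g : ℕ → ℝ) → ∃ λ k → k ℕ.≤ b × g k ≡ maxUpTo b g
  maxUpTo-attained zero    g = 0 , ℕ.z≤n , refl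
  maxUpTo-attained (suc b) g with maxUpTo-attained b g | ⊔-sel (maxUpTo b g) (g (suc b))
  ... | k , k≤b , eq | inj₁ sel = k , ℕ.m≤n⇒m≤1+n k≤b , trans eq (sym sel)
  ... | _            | inj₂ sel = suc b , ℕ.≤-refl , sym sel

  -- Provides the optimal point of the box from which the potential argument starts.
  maxBox-attained : ∀ {n} (B : Vec ℕ n) (f : Vec ℕ n → ℝ) → ∃ λ z → z ≤ᵛ B × f z ≡ maxBox B f
  maxBox-attained []      f = [] , [] , refl
  maxBox-attained (b ∷ B) f with maxUpTo-attained b (λ k → maxBox B (λ z → f (k ∷ z)))
  ... | k , k≤b , eq with maxBox-attained B (λ z → f (k ∷ z))
  ... | z , z≤B , eq′ = k ∷ z , k≤b ∷ z≤B , trans eq′ eq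

  module Potential {n} (f : Vec ℕ n → ℝ) (dr : DRSubmodular f) where

    -- The double greedy algorithm keeps x ≤ o ≤ y, where o starts as an
    -- optimal solution and is moved as little as possible.
    Φ : (x y o : Vec ℕ n) → ℝ
    Φ x y o = (f x + f y) + (f o + f o)

    -- The unit-step DR inequalities telescope along a jump of length `w`. Entry `i` of both vectors
    -- is overwritten, so the starting values `u` and `v` can be chosen freely.
    diminishing : ∀ {x y} → x ≤ᵛ y → ∀ i {u v} → u ℕ.≤ v → ∀ w →
      f (y [ i ]≔ (w ℕ.+ v)) - f (y [ i ]≔ v) ≤ f (x [ i ]≔ (w ℕ.+ u)) - f (x [ i ]≔ u)
    diminishing {x} {y} x≤y i {u} {v} u≤v zero    =
      ≤-reflexive (trans (-‿inverseʳ _) (sym (-‿inverseʳ _)))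
    diminishing {x} {y} x≤y i {u} {v} u≤v (suc w) = subst₂ _≤_
      (telescope (f (y [ i ]≔ (suc w ℕ.+ v))) (f (y [ i ]≔ (w ℕ.+ v))) (f (y [ i ]≔ v)))
      (telescope (f (x [ i ]≔ (suc w ℕ.+ u))) (f (x [ i ]≔ (w ℕ.+ u))) (f (x [ i ]≔ u)))
      (+-mono-≤ (diminishing x≤y i u≤v w) one)
      where
      one : f (y [ i ]≔ (suc w ℕ.+ v)) - f (y [ i ]≔ (w ℕ.+ v))
          ≤ f (x [ i ]≔ (suc w ℕ.+ u)) - f (x [ i ]≔ (w ℕ.+ u))
      one = subst₂ _≤_
        (cong (λ z → f z - f (y [ i ]≔ (w ℕ.+ v))) (+ᵛ-χ i y))
        (cong (λ z → f z - f (x [ i ]≔ (w ℕ.+ u))) (+ᵛ-χ i x))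
        (dr _ _ ([]≔-mono-≤ i x≤y (ℕ.+-monoʳ-≤ w u≤v)) i)
      telescope : ∀ a b c → (b - c) + (a - b) ≡ a - c
      telescope a b c = begin
        (b - c) + (a - b)    ≡⟨ solve 4 (λ b c a b′ → (b :+ c) :+ (a :+ b′) := (b :+ (a :+ b′)) :+ c)
                                  refl b (- c) a (- b) ⟩
        (b + (a - b)) - c    ≡⟨ cong (_- c) (x+[y-x]≡y b a) ⟩
        a - c                ∎
        where open ≡-Reasoning

    -- The choice between x⁺ = x + w χᵢ and y⁻ = y − w χᵢ.
    module Move {x y : Vec ℕ n} (i : Fin n) {w h : ℕ}
                (hv : Halves (lookup y i ℕ.∸ lookup x i) w h) (x≤y : x ≤ᵛ y) where
      open Halves hv

      xᵢ = lookup x i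
      yᵢ = lookup y i
      x⁺ = x [ i ]≔ (w ℕ.+ xᵢ)
      -- This is `yᵢ − w` written without truncated subtraction.
      y⁻ = y [ i ]≔ (h ℕ.+ xᵢ)
      gain⁺ = f x⁺ - f x
      gain⁻ = f y⁻ - f y

      xᵢ≤yᵢ : xᵢ ℕ.≤ yᵢ
      xᵢ≤yᵢ = Pointwise.lookup x≤y i

      yᵢ≡w+[h+xᵢ] : yᵢ ≡ w ℕ.+ (h ℕ.+ xᵢ)
      yᵢ≡w+[h+xᵢ] = begin
        yᵢ                   ≡⟨ ℕ.m∸n+n≡m xᵢ≤yᵢ ⟨
        yᵢ ℕ.∸ xᵢ ℕ.+ xᵢ     ≡⟨ cong (ℕ._+ xᵢ) w+h≡d ⟨
        w ℕ.+ h ℕ.+ xᵢ       ≡⟨ ℕ.+-assoc w h xᵢ ⟩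
        w ℕ.+ (h ℕ.+ xᵢ)     ∎
        where open ≡-Reasoning

      yᵢ≡h+[w+xᵢ] : yᵢ ≡ h ℕ.+ (w ℕ.+ xᵢ)
      yᵢ≡h+[w+xᵢ] = trans yᵢ≡w+[h+xᵢ] (shuffle w h xᵢ)
        where
        shuffle : ∀ a b c → a ℕ.+ (b ℕ.+ c) ≡ b ℕ.+ (a ℕ.+ c)
        shuffle = solve-∀

      y-restored : y [ i ]≔ (w ℕ.+ (h ℕ.+ xᵢ)) ≡ y
      y-restored = trans (cong (y [ i ]≔_) (sym yᵢ≡w+[h+xᵢ])) ([]≔-lookup y i)

      y⁻≤y : y⁻ ≤ᵛ y
      y⁻≤y = []≔-≤ i ≤ᵛ-refl (subst (h ℕ.+ xᵢ ℕ.≤_) (sym yᵢ≡w+[h+xᵢ]) (ℕ.m≤n+m (h ℕ.+ xᵢ) w))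

      module _ (xᵢ<yᵢ : xᵢ ℕ.< yᵢ) where
        fewer : ⌊log₂ (2 ℕ.* h) ⌋ ℕ.< halvings yᵢ xᵢ
        fewer = halves-< (ℕ.m<n⇒0<n∸m xᵢ<yᵢ) hv

        totalHalvings-x⁺ : totalHalvings y x⁺ ℕ.< totalHalvings y x
        totalHalvings-x⁺ = subst (λ z → totalHalvings z x⁺ ℕ.< _) ([]≔-lookup y i)
          (sum-zipWith-[]≔ halvings i y x
            (subst (λ e → ⌊log₂ (2 ℕ.* e) ⌋ ℕ.< _)
              (sym (trans (cong (ℕ._∸ (w ℕ.+ xᵢ)) yᵢ≡h+[w+xᵢ]) (ℕ.m+n∸n≡m h (w ℕ.+ xᵢ)))) fewer))

        totalHalvings-y⁻ : totalHalvings y⁻ x ℕ.< totalHalvings y x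
        totalHalvings-y⁻ = subst (λ z → totalHalvings y⁻ z ℕ.< _) ([]≔-lookup x i)
          (sum-zipWith-[]≔ halvings i y x
            (subst (λ e → ⌊log₂ (2 ℕ.* e) ⌋ ℕ.< _) (sym (ℕ.m+n∸n≡m h xᵢ)) fewer))

      -- Raising `x` by `w` gains at least as much as raising `y⁻` by `w` back to `y`, and the
      -- latter is the negative of `gain⁻`.
      gains-nonNegative : 0# ≤ gain⁺ + gain⁻
      gains-nonNegative = 0≤x-y+z (subst₂ _≤_
        (cong (λ z → f z - f y⁻) y-restored)
        (cong (λ z → f x⁺ - f z) ([]≔-lookup x i))
        (diminishing x≤y i (ℕ.m≤n+m xᵢ h) w))

      -- In each case `o` fits the interval left by one move, and a shift by exactly `w` brings it
      -- into the interval left by the other. As the shift is as long as the move, `diminishing`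
      -- bounds its loss by the gain of the rejected move.
      potential-step : ∀ {p q o} → Balanced gain⁺ gain⁻ p q → x ≤ᵛ o → o ≤ᵛ y →
        ∃₂ λ o⁺ o⁻ → (x⁺ ≤ᵛ o⁺ × o⁺ ≤ᵛ y) × (x ≤ᵛ o⁻ × o⁻ ≤ᵛ y⁻) ×
                     Φ x y o ≤ p * Φ x⁺ y o⁺ + q * Φ x y⁻ o⁻
      potential-step {p} {q} {o} bal x≤o o≤y with w ℕ.+ xᵢ ℕ.≤? lookup o i
      -- `o` stays above `x⁺`, and is lowered by `w` if `y⁻` is chosen.
      ... | yes w+xᵢ≤oᵢ = o , o⁻
          , ([]≔-≤ i x≤o w+xᵢ≤oᵢ , o≤y)
          , (≤-[]≔ i x≤o xᵢ≤v , []≔-mono-≤ i o≤y v≤h+xᵢ)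
          , subst₂ (λ A D → Φ x y o ≤ p * ((A + f y) + (f o + f o)) + q * ((f x + D) + (f o⁻ + f o⁻)))
              (x+[y-x]≡y (f x) (f x⁺)) (x+[y-x]≡y (f y) (f y⁻))
              (coin-potential bal (x-y≤z⇒x≤y+z loss) (f x) (f y))
        where
        oᵢ = lookup o i
        v  = oᵢ ℕ.∸ w
        o⁻ = o [ i ]≔ v
        w≤oᵢ : w ℕ.≤ oᵢ
        w≤oᵢ = ℕ.m+n≤o⇒m≤o w w+xᵢ≤oᵢ
        xᵢ≤v : xᵢ ℕ.≤ v
        xᵢ≤v = ℕ.m+n≤o⇒m≤o∸n xᵢ (subst (ℕ._≤ oᵢ) (ℕ.+-comm w xᵢ) w+xᵢ≤oᵢ)
        v≤h+xᵢ : v ℕ.≤ h ℕ.+ xᵢ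
        v≤h+xᵢ = ℕ.m≤n+o⇒m∸n≤o oᵢ w (subst (oᵢ ℕ.≤_) yᵢ≡w+[h+xᵢ] (Pointwise.lookup o≤y i))
        o-restored : o [ i ]≔ (w ℕ.+ v) ≡ o
        o-restored = trans (cong (o [ i ]≔_) (ℕ.m+[n∸m]≡n w≤oᵢ)) ([]≔-lookup o i)
        loss : f o - f o⁻ ≤ gain⁺
        loss = subst₂ _≤_ (cong (λ z → f z - f o⁻) o-restored) (cong (λ z → f x⁺ - f z) ([]≔-lookup x i))
          (diminishing x≤o i xᵢ≤v w)
      ... | no w+xᵢ≰oᵢ = o⁺ , o
          , ([]≔-mono-≤ i x≤o (ℕ.+-monoʳ-≤ w xᵢ≤oᵢ) , []≔-≤ i o≤y w+oᵢ≤yᵢ)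
          , (x≤o , ≤-[]≔ i o≤y oᵢ≤h+xᵢ)
          , subst₂ (λ A D → Φ x y o ≤ p * ((A + f y) + (f o⁺ + f o⁺)) + q * ((f x + D) + (f o + f o)))
              (x+[y-x]≡y (f x) (f x⁺)) (x+[y-x]≡y (f y) (f y⁻))
              (coin-potential-sym bal (x-y≤u-v⇒v≤u+[y-x] loss) (f x) (f y))
        where
        oᵢ = lookup o i
        o⁺ = o [ i ]≔ (w ℕ.+ oᵢ)
        xᵢ≤oᵢ : xᵢ ℕ.≤ oᵢ
        xᵢ≤oᵢ = Pointwise.lookup x≤o i
        -- From `oᵢ < w + xᵢ` and `w ≤ 1 + h`: rounding leaves no gap between the two cases, so here
        -- `o` fits below `y⁻`.
        oᵢ≤h+xᵢ : oᵢ ℕ.≤ h ℕ.+ xᵢ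
        oᵢ≤h+xᵢ = ℕ.s≤s⁻¹ (ℕ.≤-trans (ℕ.≰⇒> w+xᵢ≰oᵢ) (ℕ.+-monoˡ-≤ xᵢ w≤1+h))
        w+oᵢ≤yᵢ : w ℕ.+ oᵢ ℕ.≤ yᵢ
        w+oᵢ≤yᵢ = subst (w ℕ.+ oᵢ ℕ.≤_) (sym yᵢ≡w+[h+xᵢ]) (ℕ.+-monoʳ-≤ w oᵢ≤h+xᵢ)
        loss : f y - f y⁻ ≤ f o⁺ - f o
        loss = subst₂ _≤_ (cong (λ z → f z - f y⁻) y-restored) (cong (λ z → f o⁺ - f z) ([]≔-lookup o i))
          (diminishing o≤y i oᵢ≤h+xᵢ w)
        x-y≤u-v⇒v≤u+[y-x] : ∀ {x y u v} → x - y ≤ u - v → v ≤ u + (y - x)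
        x-y≤u-v⇒v≤u+[y-x] {x} {y} {u} {v} le = begin
          v                          ≡⟨ +-identityʳ v ⟨
          v + 0#                     ≤⟨ +-monoʳ-≤ v (0≤x-y+z le) ⟩
          v + ((u - v) + (y - x))    ≡⟨ +-assoc v (u - v) (y - x) ⟨
          (v + (u - v)) + (y - x)    ≡⟨ cong (_+ (y - x)) (x+[y-x]≡y v u) ⟩
          u + (y - x)                ∎
          where open ≤-Reasoning

-- Memory updates and the vectors stored in memory.

↦-same : ∀ {A : Set} (m : ℕ → A) a v → (m [ a ↦ v ]) a ≡ v
↦-same m a v with a ℕ.≡ᵇ a in eq
... | true  = refl
... | false = contradiction (ℕ.≡⇒≡ᵇ a a refl) (subst T eq)

↦-other : ∀ {A : Set} (m : ℕ → A) {a b} v → a ≢ b → (m [ a ↦ v ]) b ≡ m b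
↦-other m {a} {b} v a≢b with a ℕ.≡ᵇ b in eq
... | true  = contradiction (ℕ.≡ᵇ⇒≡ a b (subst T (sym eq) tt)) a≢b
... | false = refl

-- `vectorAt` as a function of the memory alone; the two agree definitionally.
slice : ∀ {n} → (ℕ → ℕ) → ℕ → Vec ℕ n
slice m a = tabulate (λ j → m (a ℕ.+ toℕ j))

slice-inside : ∀ {n} (m : ℕ → ℕ) a (i : Fin n) {b v} → b ≡ a ℕ.+ toℕ i →
               slice (m [ b ↦ v ]) a ≡ slice m a [ i ]≔ v
slice-inside m a i {v = v} refl = lookup-injective entry
  where
  entry : ∀ j → lookup (slice (m [ a ℕ.+ toℕ i ↦ v ]) a) j ≡ lookup (slice m a [ i ]≔ v) j
  entry j with i Fin.≟ j
  ... | yes refl = trans (lookup∘tabulate _ i)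
                     (trans (↦-same m (a ℕ.+ toℕ i) v) (sym (lookup∘update i (slice m a) v)))
  ... | no i≢j   = trans (lookup∘tabulate _ j)
                     (trans (↦-other m v (i≢j ∘ Fin.toℕ-injective ∘ ℕ.+-cancelˡ-≡ a _ _))
                       (sym (trans (lookup∘update′ (≢-sym i≢j) (slice m a) v) (lookup∘tabulate _ j))))

slice-outside : ∀ {n} (m : ℕ → ℕ) a {b v} → (∀ (j : Fin n) → b ≢ a ℕ.+ toℕ j) →
                slice {n} (m [ b ↦ v ]) a ≡ slice m a
slice-outside m a b≢ = tabulate-cong (λ j → ↦-other m _ (b≢ j))

slice-contents : ∀ {n} (B : Vec ℕ n) → slice (contents B) 0 ≡ B
slice-contents []      = refl
slice-contents (b ∷ B) = cong (b ∷_) (slice-contents B)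

-- The zeros behind the input serve as the initial lower vector, so the program need not write it.
slice-padding : ∀ {n} (B : Vec ℕ n) → slice (contents B) n ≡ replicate n 0
slice-padding {n} B = lookup-injective (λ j →
    trans (lookup∘tabulate _ j) (trans (padding B (toℕ j)) (sym (lookup-replicate j 0))))
  where
  padding : ∀ {m} (B : Vec ℕ m) j → contents B (m ℕ.+ j) ≡ 0
  padding []      j = refl
  padding (_ ∷ B) j = padding B j

≮ᵇ⇒≥ : ∀ m {k} → T (not (m ℕ.<ᵇ k)) → k ℕ.≤ m
≮ᵇ⇒≥ m {k} m≮k = ℕ.≮⇒≥ (contradictory (m ℕ.<ᵇ k) m≮k ∘ ℕ.<⇒<ᵇ)
  where
  contradictory : ∀ b → T (not b) → ¬ T b
  contradictory true ()

-- The double greedy program.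

-- Integer registers: 0 holds n, 1 the current
-- coordinate i, which is also the address of yᵢ, 2 the address n + i of xᵢ,
-- 3 and 4 the entries xᵢ and yᵢ, 5 and 6 the parts w and h of yᵢ − xᵢ, 7 and
-- 8 the candidates xᵢ + w and yᵢ − w, 10 is scratch, and 9 is never written.
-- Real registers: 1 and 2 hold the two gains, 5 the bias of the coin, and 0
-- is never written.

measureGains : List Instr
measureGains =
  const 6 2 ∷ ℕ-op sub 5 4 3 ∷ ℕ-op div 6 5 6 ∷ ℕ-op sub 5 5 6 ∷
  ℕ-op add 7 3 5 ∷ ℕ-op sub 8 4 5 ∷
  -- Register 0 holds `n`, the address of the lower vector, and register 9 holds 0, that of the
  -- upper one. These queries precede both writes.
  query 1 0 ∷ query 3 9 ∷
  store 7 2 ∷ query 2 0 ∷ store 8 1 ∷ query 4 9 ∷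
  ℝ-op sub 1 2 1 ∷ ℝ-op sub 2 4 3 ∷ []

-- The bias is 1 if `gain⁻` is not positive, otherwise 0 if `gain⁺` is not positive, and otherwise
-- the ratio, whose denominator is then positive.
computeBias : Instr
computeBias =
  branch (2 ≤ʳ 0) (const 10 1 ∷ toReal 5 10 ∷ [])
    (branch (1 ≤ʳ 0) (toReal 5 9 ∷ []) (ℝ-op add 3 1 2 ∷ ℝ-op div 5 1 3 ∷ []) ∷ [])

-- Both candidates are in memory, so one of them is undone.
tossCoin : List Instr
tossCoin = flip 10 5 ∷ branch (9 <ⁿ 10) (store 4 1 ∷ []) (store 3 2 ∷ []) ∷ []

moveCoordinate nextCoordinate loopBody : List Instr
moveCoordinate = measureGains ++ computeBias ∷ tossCoin
nextCoordinate = const 10 1 ∷ ℕ-op add 1 1 10 ∷ []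
loopBody =
  ℕ-op add 2 0 1 ∷ load 3 2 ∷ load 4 1 ∷
  branch (3 <ⁿ 4) moveCoordinate nextCoordinate ∷ []

-- Register 0 keeps `n`, which is both the loop bound and the address of the lower vector, hence of
-- the output.
doubleGreedy : Program
doubleGreedy = while (1 <ⁿ 0) loopBody ∷ []

straight : Instr → Bool
straight (flip _ _)     = false
straight (branch _ _ _) = false
straight (while _ _)    = false
straight _              = true

-- Guarantees for runs of the machine.

module Analysis (R : Reals) {n : ℕ} (B : Vec ℕ n)
                (f : Vec ℕ n → Reals.ℝ R) (dr : Lattice.DRSubmodular R f) where
  open Reals R
  open Lattice R
  open Probability R
  open Machine R
  open OrderedField R
  open DoubleGreedy R
  open Potential f dr

  -- Four times `f` at the output: the potential once `x`, `o` and `y` have met.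
  payoff : Config → ℝ
  payoff c = Φ (output c) (output c) (output c)

  Acceptable : Config → Set
  Acceptable c = Halted c × output c ≤ᵛ B

  -- Demanded for every number of steps from `τ` on, so that paths of different lengths can be given
  -- a common bound.
  record Guarantee (τ : ℕ) (c : Config) (v : ℝ) : Set where
    field
      after : ∀ t → let μ = run f (τ ℕ.+ t) c in AllOutcomes Acceptable μ × v ≤ 𝔼 payoff μ

  open Guarantee

  weaken-time : ∀ k {τ c v} → Guarantee τ c v → Guarantee (k ℕ.+ τ) c v
  weaken-time k {τ} {c} {v} g .after t = subst
    (λ τ → AllOutcomes Acceptable (run f τ c) × v ≤ 𝔼 payoff (run f τ c))
    (shuffle τ k t) (g .after (k ℕ.+ t))
    where
    shuffle : ∀ τ k t → τ ℕ.+ (k ℕ.+ t) ≡ k ℕ.+ τ ℕ.+ t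
    shuffle = solve-∀

  guarantee-halted : ∀ τ {s v} → output ([] , s) ≤ᵛ B → v ≤ payoff ([] , s) → Guarantee τ ([] , s) v
  guarantee-halted τ {s} {v} out≤B v≤ .after t = go (τ ℕ.+ t)
    where
    go : ∀ t → AllOutcomes Acceptable (run f t ([] , s)) × v ≤ 𝔼 payoff (run f t ([] , s))
    go zero    = (refl , out≤B) , v≤
    go (suc t) = go t

  guarantee-branch : ∀ {τ t P Q K s v} →
    (T (test t s) → Guarantee τ (P ++ K , s) v) →
    (T (not (test t s)) → Guarantee τ (Q ++ K , s) v) →
    Guarantee (suc τ) (branch t P Q ∷ K , s) v
  guarantee-branch {t = t} {s = s} gᵗ gᶠ .after t′ with test t s
  ... | true  = gᵗ tt .after t′
  ... | false = gᶠ tt .after t′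

  guarantee-while : ∀ {τ t P K s v} →
    (T (test t s) → Guarantee τ (P ++ while t P ∷ K , s) v) →
    (T (not (test t s)) → Guarantee τ (K , s) v) →
    Guarantee (suc τ) (while t P ∷ K , s) v
  guarantee-while {t = t} {s = s} gᵗ gᶠ .after t′ with test t s
  ... | true  = gᵗ tt .after t′
  ... | false = gᶠ tt .after t′

  clamp-unit : ∀ {p} → 0# ≤ p → p ≤ 1# → clamp p ≡ p
  clamp-unit 0≤p p≤1 =
    trans (cong (0# ⊔_) (Min.x≤y⇒x⊓y≈x totalOrder p≤1)) (Max.x≤y⇒x⊔y≈y totalOrder 0≤p)

  -- A balanced bias lies in the unit interval, so clamping leaves it unchanged and the two
  -- guarantees average with weights `p` and `q`.
  guarantee-flip : ∀ {τ d r K s v₁ v₀ v a b q} → Balanced a b (regʳ s r) q →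
    Guarantee τ (K , setReg d 1 s) v₁ → Guarantee τ (K , setReg d 0 s) v₀ →
    v ≤ regʳ s r * v₁ + q * v₀ → Guarantee (suc τ) (flip d r ∷ K , s) v
  guarantee-flip {τ} {d} {r} {K} {s} {v₁} {v₀} {v} {q = q} bal g₁ g₀ v≤ .after t =
    (proj₁ (g₁ .after t) , proj₁ (g₀ .after t)) , (begin
    v                                  ≤⟨ v≤ ⟩
    p * v₁ + q * v₀                    ≤⟨ +-mono-≤ (*-monoʳ-≤ 0≤p (proj₂ (g₁ .after t)))
                                                   (*-monoʳ-≤ 0≤q (proj₂ (g₀ .after t))) ⟩
    p * e₁ + q * e₀                    ≡⟨ cong (λ q → p * e₁ + q * e₀) (balanced⇒1-p≡q bal) ⟨
    p * e₁ + (1# - p) * e₀             ≡⟨ cong (λ p → p * e₁ + (1# - p) * e₀) (clamp-unit 0≤p (balanced⇒p≤1 bal)) ⟨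
    clamp p * e₁ + (1# - clamp p) * e₀ ∎)
    where
    open Balanced bal
    open ≤-Reasoning
    p = regʳ s r
    e₁ = 𝔼 payoff (run f (τ ℕ.+ t) (K , setReg d 1 s))
    e₀ = 𝔼 payoff (run f (τ ℕ.+ t) (K , setReg d 0 s))

  effect : Instr → State → State
  effect I s = outcome (step f (I ∷ [] , s))
    where
    outcome : Dist Config → State
    outcome (pure (_ , s)) = s
    -- A default value: `step` builds a coin only for `flip`, which is not straight.
    outcome (coin _ μ _)   = outcome μ

  execute : List Instr → State → State
  execute []      s = s
  execute (I ∷ P) s = execute P (effect I s)

  step-straight : ∀ I → T (straight I) → ∀ K s → step f (I ∷ K , s) ≡ pure (K , effect I s)
  step-straight (const _ _)    _ K s = refl
  step-straight (ℕ-op _ _ _ _) _ K s = refl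
  step-straight (load _ _)     _ K s = refl
  step-straight (store _ _)    _ K s = refl
  step-straight (toReal _ _)   _ K s = refl
  step-straight (ℝ-op _ _ _ _) _ K s = refl
  step-straight (loadʳ _ _)    _ K s = refl
  step-straight (storeʳ _ _)   _ K s = refl
  step-straight (query _ _)    _ K s = refl

  -- Straight instructions are deterministic and cost one step each, so a block of them is run by
  -- evaluation.
  guarantee-straight : ∀ P → T (all straight P) → ∀ {τ K s v} →
    Guarantee τ (K , execute P s) v → Guarantee (length P ℕ.+ τ) (P ++ K , s) v
  guarantee-straight []      _  g = g
  guarantee-straight (I ∷ P) st {τ} {K} {s} {v} g .after t =
      subst (λ μ → AllOutcomes Acceptable (μ >>= run f (length P ℕ.+ τ ℕ.+ t)) ×
                   v ≤ 𝔼 payoff (μ >>= run f (length P ℕ.+ τ ℕ.+ t)))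
        (sym (step-straight I (proj₁ split) (P ++ K) s))
        (guarantee-straight P (proj₂ split) g .after t)
    where
    split : T (straight I) × T (all straight P)
    split = Equivalence.to T-∧ st

  -- The loop invariant and the termination measure.

  record Invariant (s : State) (x y : Vec ℕ n) : Set where
    field
      size    : reg s 0 ≡ n
      zeroᴺ   : reg s 9 ≡ 0
      zeroᴿ   : regʳ s 0 ≡ 0#
      lower   : vectorAt s n ≡ x
      upper   : vectorAt s 0 ≡ y
      settled : ∀ j → toℕ j ℕ.< reg s 1 → lookup x j ≡ lookup y j

  -- Every iteration either passes to the next coordinate or halves an interval, and so lowers this
  -- measure.
  remaining : State → (x y : Vec ℕ n) → ℕ
  remaining s x y = (n ℕ.∸ reg s 1) ℕ.+ totalHalvings y x

  -- It covers every `o` between `x` and `y`, because the two sides of a coin continue with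
  -- different ones.
  LoopGuarantee : ℕ → ℕ → Set
  LoopGuarantee k τ = ∀ {s x y o} → Invariant s x y → x ≤ᵛ o → o ≤ᵛ y → y ≤ᵛ B →
    remaining s x y ℕ.≤ k → Guarantee τ (doubleGreedy , s) (Φ x y o)

  -- One iteration of the loop.

  module Step (s : State) {x y o : Vec ℕ n} (inv : Invariant s x y)
              (i : Fin n) (reg₁≡i : reg s 1 ≡ toℕ i)
              (x≤o : x ≤ᵛ o) (o≤y : o ≤ᵛ y) (y≤B : y ≤ᵛ B)
              {k τ : ℕ} (remaining≤ : remaining s x y ℕ.≤ suc k) (next : LoopGuarantee k τ) where
    open Invariant inv

    x≤y : x ≤ᵛ y
    x≤y = ≤ᵛ-trans x≤o o≤y

    i<n : reg s 1 ℕ.< n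
    i<n = subst (ℕ._< n) (sym reg₁≡i) (Fin.toℕ<n i)

    advance : lookup x i ≡ lookup y i → Guarantee (2 ℕ.+ τ) (nextCoordinate ++ doubleGreedy , s) (Φ x y o)
    advance xᵢ≡yᵢ = guarantee-straight nextCoordinate tt (next inv′ x≤o o≤y y≤B
      (ℕ.s≤s⁻¹ (ℕ.≤-trans
        (ℕ.+-monoˡ-< (totalHalvings y x)
          (ℕ.∸-monoʳ-< (ℕ.≤-reflexive (sym reg₁+1)) (subst (ℕ._≤ n) (sym reg₁+1) i<n)))
        remaining≤)))
      where
      reg₁+1 : reg s 1 ℕ.+ 1 ≡ suc (reg s 1)
      reg₁+1 = ℕ.+-comm (reg s 1) 1
      settled′ : ∀ j → toℕ j ℕ.< reg s 1 ℕ.+ 1 → lookup x j ≡ lookup y j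
      settled′ j j<i+1 with ℕ.m<1+n⇒m<n∨m≡n (subst (toℕ j ℕ.<_) reg₁+1 j<i+1)
      ... | inj₁ j<i = settled j j<i
      ... | inj₂ j≡i with Fin.toℕ-injective (trans j≡i reg₁≡i)
      ... | refl = xᵢ≡yᵢ
      inv′ : Invariant (execute nextCoordinate s) x y
      inv′ = record
        { size = size ; zeroᴺ = zeroᴺ ; zeroᴿ = zeroᴿ
        ; lower = lower ; upper = upper ; settled = settled′ }

    module _ (address : reg s 2 ≡ n ℕ.+ toℕ i)
             (lowerEntry : reg s 3 ≡ lookup x i) (upperEntry : reg s 4 ≡ lookup y i)
             (xᵢ<yᵢ : lookup x i ℕ.< lookup y i) where

      d h w : ℕ
      d = lookup y i ℕ.∸ lookup x i
      h = d / 2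
      w = d ℕ.∸ h
      open Move {x} {y} i (halves d) x≤y

      -- The upper vector occupies the cells below `n` and the lower vector those from `n` on, so a
      -- write to one spares the other.
      low≢ : ∀ {b} → b ≡ toℕ i → ∀ (j : Fin n) → b ≢ n ℕ.+ toℕ j
      low≢ b≡i j b≡n+j = ℕ.<⇒≱ (Fin.toℕ<n i) (subst (n ℕ.≤_) (trans (sym b≡n+j) b≡i) (ℕ.m≤m+n n (toℕ j)))

      high≢ : ∀ {b} → b ≡ n ℕ.+ toℕ i → ∀ (j : Fin n) → b ≢ toℕ j
      high≢ b≡n+i j b≡j = ℕ.<⇒≱ (Fin.toℕ<n j) (subst (n ℕ.≤_) (trans (sym b≡n+i) b≡j) (ℕ.m≤m+n n (toℕ i)))

      -- Between the queries and the coin, with both moves made.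
      record Pending (s′ : State) : Set where
        field
          size′    : reg s′ 0 ≡ n
          index′   : reg s′ 1 ≡ toℕ i
          address′ : reg s′ 2 ≡ n ℕ.+ toℕ i
          lower₃   : reg s′ 3 ≡ lookup x i
          upper₄   : reg s′ 4 ≡ lookup y i
          zeroᴺ′   : reg s′ 9 ≡ 0
          zeroᴿ′   : regʳ s′ 0 ≡ 0#
          raised   : vectorAt s′ n ≡ x⁺
          lowered  : vectorAt s′ 0 ≡ y⁻

      earlier : ∀ {s′} → Pending s′ → ∀ j → toℕ j ℕ.< reg s′ 1 → toℕ j ℕ.< reg s 1 × j ≢ i
      earlier {s′} pend j j<i = subst (toℕ j ℕ.<_) (trans index′ (sym reg₁≡i)) j<i
                         , λ { refl → ℕ.<-irrefl (sym index′) j<i }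
        where open Pending pend

      decrease : ∀ {s′} → Pending s′ → ∀ {x′ y′} → totalHalvings y′ x′ ℕ.< totalHalvings y x →
                 remaining s′ x′ y′ ℕ.≤ k
      decrease pend fewer = ℕ.s≤s⁻¹ (ℕ.≤-trans
        (ℕ.+-mono-≤-< (ℕ.≤-reflexive (cong (n ℕ.∸_) (trans index′ (sym reg₁≡i)))) fewer) remaining≤)
        where open Pending pend

      heads : ∀ {s′ o′} → Pending s′ → x⁺ ≤ᵛ o′ → o′ ≤ᵛ y →
              Guarantee (suc τ) (store 4 1 ∷ doubleGreedy , s′) (Φ x⁺ y o′)
      heads {s′} pend x⁺≤o′ o′≤y = guarantee-straight (store 4 1 ∷ []) tt (next (record
        { size = size′ ; zeroᴺ = zeroᴺ′ ; zeroᴿ = zeroᴿ′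
        ; lower = trans (slice-outside (mem s′) n (low≢ index′)) raised
        ; upper = begin
            slice (mem s′ [ reg s′ 1 ↦ reg s′ 4 ]) 0  ≡⟨ slice-inside (mem s′) 0 i index′ ⟩
            slice (mem s′) 0 [ i ]≔ reg s′ 4          ≡⟨ cong₂ (_[ i ]≔_) lowered upper₄ ⟩
            y⁻ [ i ]≔ lookup y i                      ≡⟨ []≔-idempotent y i ⟩
            y [ i ]≔ lookup y i                       ≡⟨ []≔-lookup y i ⟩
            y                                         ∎
        ; settled = λ j j<i → let j<i , j≢i = earlier pend j j<i in
            trans (lookup∘update′ j≢i x _) (settled j j<i)
        }) x⁺≤o′ o′≤y y≤B (decrease pend {x⁺} {y} (totalHalvings-x⁺ xᵢ<yᵢ)))
        where
        open Pending pend
        open ≡-Reasoning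

      tails : ∀ {s′ o′} → Pending s′ → x ≤ᵛ o′ → o′ ≤ᵛ y⁻ →
              Guarantee (suc τ) (store 3 2 ∷ doubleGreedy , s′) (Φ x y⁻ o′)
      tails {s′} pend x≤o′ o′≤y⁻ = guarantee-straight (store 3 2 ∷ []) tt (next (record
        { size = size′ ; zeroᴺ = zeroᴺ′ ; zeroᴿ = zeroᴿ′
        ; lower = begin
            slice (mem s′ [ reg s′ 2 ↦ reg s′ 3 ]) n  ≡⟨ slice-inside (mem s′) n i address′ ⟩
            slice (mem s′) n [ i ]≔ reg s′ 3          ≡⟨ cong₂ (_[ i ]≔_) raised lower₃ ⟩
            x⁺ [ i ]≔ lookup x i                      ≡⟨ []≔-idempotent x i ⟩
            x [ i ]≔ lookup x i                       ≡⟨ []≔-lookup x i ⟩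
            x                                         ∎
        ; upper = trans (slice-outside (mem s′) 0 (high≢ address′)) lowered
        ; settled = λ j j<i → let j<i , j≢i = earlier pend j j<i in
            trans (settled j j<i) (sym (lookup∘update′ j≢i y _))
        }) x≤o′ o′≤y⁻ (≤ᵛ-trans y⁻≤y y≤B) (decrease pend {x} {y⁻} (totalHalvings-y⁻ xᵢ<yᵢ)))
        where
        open Pending pend
        open ≡-Reasoning

      pending-setReg₁₀ : ∀ {s′} v → Pending s′ → Pending (setReg 10 v s′)
      pending-setReg₁₀ v pend = record { Pending pend }

      -- The register has the form `suc r` because real register 0 must keep its zero.
      pending-setRegʳ : ∀ {s′} r v → Pending s′ → Pending (setRegʳ (suc r) v s′)
      pending-setRegʳ r v pend = record { Pending pend }

      toss : ∀ {s′ q} → Pending s′ → Balanced gain⁺ gain⁻ (regʳ s′ 5) q →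
             Guarantee (3 ℕ.+ τ) (tossCoin ++ doubleGreedy , s′) (Φ x y o)
      toss {s′} pend bal =
        let o⁺ , o⁻ , (x⁺≤o⁺ , o⁺≤y) , (x≤o⁻ , o⁻≤y⁻) , Φ≤ = potential-step bal x≤o o≤y in
        guarantee-flip bal
          (guarantee-branch
            (λ _ → heads (pending-setReg₁₀ 1 pend) x⁺≤o⁺ o⁺≤y)
            (λ 0≮1 → contradiction 0≮1 (subst (λ z → ¬ T (not (z ℕ.<ᵇ 1))) (sym zeroᴺ′) (λ ()))))
          (guarantee-branch
            (λ 0<0 → contradiction (ℕ.<ᵇ⇒< (reg s′ 9) 0 0<0) (λ ()))
            (λ _ → tails (pending-setReg₁₀ 0 pend) x≤o⁻ o⁻≤y⁻))
          Φ≤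
        where open Pending pend

      -- The longest path takes seven steps: two branches, two instructions for the ratio and three
      -- for the toss. The other two paths take six.
      bias : ∀ {s′} → Pending s′ → regʳ s′ 1 ≡ gain⁺ → regʳ s′ 2 ≡ gain⁻ →
             Guarantee (7 ℕ.+ τ) (computeBias ∷ tossCoin ++ doubleGreedy , s′) (Φ x y o)
      bias {s′} pend eq⁺ eq⁻ = guarantee-branch
          (λ t → weaken-time 1 (guarantee-straight (const 10 1 ∷ toReal 5 10 ∷ []) tt (toss
             (pending-setRegʳ 4 _ (pending-setReg₁₀ 1 pend))
             -- The register holds `fromℕ 1`, which unfolds to `1# + 0#`.
             (subst (λ p → Balanced gain⁺ gain⁻ p 0#) (sym (+-identityʳ 1#))
               (balanced-one gains-nonNegative (subst₂ _≤_ eq⁻ zeroᴿ′ (toWitness t)))))))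
          (λ t → guarantee-branch
            (λ t′ → weaken-time 1 (guarantee-straight (toReal 5 9 ∷ []) tt (toss
              (pending-setRegʳ 4 _ pend)
              (subst (λ z → Balanced gain⁺ gain⁻ (fromℕ z) 1#) (sym zeroᴺ′)
                (balanced-zero gains-nonNegative (subst₂ _≤_ eq⁺ zeroᴿ′ (toWitness t′)))))))
            (λ t′ → guarantee-straight (ℝ-op add 3 1 2 ∷ ℝ-op div 5 1 3 ∷ []) tt (toss
              (pending-setRegʳ 4 _ (pending-setRegʳ 2 _ pend))
              (subst₂ (λ a b → Balanced gain⁺ gain⁻ (a * (a + b) ⁻¹) (gain⁻ * (gain⁺ + gain⁻) ⁻¹))
                (sym eq⁺) (sym eq⁻)
                (ratio (subst₂ (λ a z → ¬ (a ≤ z)) eq⁺ zeroᴿ′ (toWitnessFalse t′))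
                       (subst₂ (λ a z → ¬ (a ≤ z)) eq⁻ zeroᴿ′ (toWitnessFalse t)))))))
        where
        open Pending pend
        ratio : ¬ gain⁺ ≤ 0# → ¬ gain⁻ ≤ 0# →
                Balanced gain⁺ gain⁻ (gain⁺ * (gain⁺ + gain⁻) ⁻¹) (gain⁻ * (gain⁺ + gain⁻) ⁻¹)
        ratio gain⁺≰0 gain⁻≰0 = balanced-ratio 0≤gain⁺ 0≤gain⁻ (λ sum≡0 → gain⁺≰0 (begin
            gain⁺           ≡⟨ +-identityʳ gain⁺ ⟨
            gain⁺ + 0#      ≤⟨ +-monoʳ-≤ gain⁺ 0≤gain⁻ ⟩
            gain⁺ + gain⁻   ≡⟨ sum≡0 ⟩
            0#              ∎))
          where
          open ≤-Reasoning
          ≰0⇒0≤ : ∀ {a} → ¬ a ≤ 0# → 0# ≤ a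
          ≰0⇒0≤ {a} a≰0 with total 0# a
          ... | inj₁ 0≤a = 0≤a
          ... | inj₂ a≤0 = contradiction a≤0 a≰0
          0≤gain⁺ = ≰0⇒0≤ gain⁺≰0
          0≤gain⁻ = ≰0⇒0≤ gain⁻≰0

      -- Fourteen steps measure the gains; seven choose the bias and toss the coin.
      move : Guarantee (21 ℕ.+ τ) (moveCoordinate ++ doubleGreedy , s) (Φ x y o)
      move = guarantee-straight measureGains tt (bias pend
          (cong₂ (λ u v → f u - f v) query₂ (trans (cong (slice (mem s)) size) lower))
          (cong₂ (λ u v → f u - f v) query₄ (trans (cong (slice (mem s)) zeroᴺ) upper)))
        where
        open ≡-Reasoning
        s′ = execute measureGains s
        halfGap : reg s 4 ℕ.∸ reg s 3 ≡ d
        halfGap = cong₂ ℕ._∸_ upperEntry lowerEntry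
        wide : reg s′ 5 ≡ w
        wide = cong (λ d → d ℕ.∸ d / 2) halfGap
        reg₇ : reg s′ 7 ≡ w ℕ.+ lookup x i
        reg₇ = trans (cong₂ ℕ._+_ lowerEntry wide) (ℕ.+-comm (lookup x i) w)
        reg₈ : reg s′ 8 ≡ h ℕ.+ lookup x i
        reg₈ = begin
          reg s 4 ℕ.∸ reg s′ 5                        ≡⟨ cong₂ ℕ._∸_ (trans upperEntry yᵢ≡w+[h+xᵢ]) wide ⟩
          w ℕ.+ (h ℕ.+ lookup x i) ℕ.∸ w              ≡⟨ ℕ.m+n∸m≡n w _ ⟩
          h ℕ.+ lookup x i                            ∎
        m₁ m₂ : ℕ → ℕ
        m₁ = mem s [ reg s 2 ↦ reg s′ 7 ]
        m₂ = m₁ [ reg s 1 ↦ reg s′ 8 ]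
        raised₁ : slice m₁ n ≡ x⁺
        raised₁ = trans (slice-inside (mem s) n i address) (cong₂ (_[ i ]≔_) lower reg₇)
        raised₂ : slice m₂ n ≡ x⁺
        raised₂ = trans (slice-outside m₁ n (low≢ reg₁≡i)) raised₁
        lowered₂ : slice m₂ 0 ≡ y⁻
        lowered₂ = trans (slice-inside m₁ 0 i reg₁≡i)
          (cong₂ (_[ i ]≔_) (trans (slice-outside (mem s) 0 (high≢ address)) upper) reg₈)
        query₂ : slice m₁ (reg s 0) ≡ x⁺
        query₂ = trans (cong (slice m₁) size) raised₁
        query₄ : slice m₂ (reg s 9) ≡ y⁻
        query₄ = trans (cong (slice m₂) zeroᴺ) lowered₂
        pend : Pending s′
        pend = record
          { size′ = size ; index′ = reg₁≡i ; address′ = address ; lower₃ = lowerEntry ; upper₄ = upperEntry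
          ; zeroᴺ′ = zeroᴺ ; zeroᴿ′ = zeroᴿ ; raised = raised₂ ; lowered = lowered₂ }

  -- The whole loop.

  guarantee-done : ∀ τ {s x y o} → Invariant s x y → x ≤ᵛ o → o ≤ᵛ y → y ≤ᵛ B → reg s 0 ℕ.≤ reg s 1 →
                   Guarantee τ ([] , s) (Φ x y o)
  guarantee-done τ {s} {x} {y} {o} inv x≤o o≤y y≤B n≤i =
      guarantee-halted τ (subst (_≤ᵛ B) (sym out≡y) y≤B) (≤-reflexive Φ≡)
    where
    open Invariant inv
    open ≡-Reasoning
    x≡y : x ≡ y
    x≡y = lookup-injective (λ j → settled j (ℕ.<-≤-trans (Fin.toℕ<n j) (subst (ℕ._≤ reg s 1) size n≤i)))
    o≡y : o ≡ y
    o≡y = ≤ᵛ-antisym o≤y (subst (_≤ᵛ o) x≡y x≤o)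
    out≡y : vectorAt s (reg s 0) ≡ y
    out≡y = trans (cong (slice (mem s)) size) (trans lower x≡y)
    Φ≡ : Φ x y o ≡ payoff ([] , s)
    Φ≡ = begin
      Φ x y o         ≡⟨ cong₂ (λ x o → Φ x y o) x≡y o≡y ⟩
      Φ y y y         ≡⟨ cong (λ z → Φ z z z) out≡y ⟨
      payoff ([] , s) ∎

  -- An iteration takes at most 26 steps, and the last test one more.
  guarantee-loop : ∀ k → LoopGuarantee k (k ℕ.* 26 ℕ.+ 1)
  guarantee-loop zero {s} inv x≤o o≤y y≤B remaining≤0 = guarantee-while
    (λ i<n → contradiction remaining≤0 (ℕ.<⇒≱ (ℕ.≤-trans
      (ℕ.m<n⇒0<n∸m (subst (reg s 1 ℕ.<_) (Invariant.size inv) (ℕ.<ᵇ⇒< _ _ i<n))) (ℕ.m≤m+n _ _))))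
    (λ i≮n → guarantee-done 0 inv x≤o o≤y y≤B (≮ᵇ⇒≥ (reg s 1) i≮n))
  guarantee-loop (suc k) {s} {x} {y} {o} inv x≤o o≤y y≤B remaining≤ =
      guarantee-while continue (λ i≮n → guarantee-done _ inv x≤o o≤y y≤B (≮ᵇ⇒≥ (reg s 1) i≮n))
    where
    open Invariant inv
    continue : T (reg s 1 ℕ.<ᵇ reg s 0) →
               Guarantee (25 ℕ.+ (k ℕ.* 26 ℕ.+ 1)) (loopBody ++ doubleGreedy , s) (Φ x y o)
    -- 25 = 3 + 1 + 21: the prefix, the branch and its longer arm. The shorter arm takes 2 steps and
    -- is padded by 19.
    continue i<n = guarantee-straight prefix tt (guarantee-branch
        (λ xᵢ<yᵢ → move address lowerEntry upperEntry
          (subst₂ ℕ._<_ lowerEntry upperEntry (ℕ.<ᵇ⇒< _ _ xᵢ<yᵢ)))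
        (λ xᵢ≮yᵢ → weaken-time 19 (advance (ℕ.≤-antisym
          (Pointwise.lookup x≤y i)
          (subst₂ ℕ._≤_ upperEntry lowerEntry (≮ᵇ⇒≥ (reg s′ 3) xᵢ≮yᵢ))))))
      where
      reg₁<n : reg s 1 ℕ.< n
      reg₁<n = subst (reg s 1 ℕ.<_) size (ℕ.<ᵇ⇒< _ _ i<n)
      i : Fin n
      i = fromℕ< reg₁<n
      reg₁≡i : reg s 1 ≡ toℕ i
      reg₁≡i = sym (Fin.toℕ-fromℕ< reg₁<n)
      prefix : List Instr
      prefix = ℕ-op add 2 0 1 ∷ load 3 2 ∷ load 4 1 ∷ []
      s′ : State
      s′ = execute prefix s
      address : reg s′ 2 ≡ n ℕ.+ toℕ i
      address = cong₂ ℕ._+_ size reg₁≡i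
      lowerEntry : reg s′ 3 ≡ lookup x i
      lowerEntry = trans (cong (mem s) address)
        (trans (sym (lookup∘tabulate _ i)) (cong (λ z → lookup z i) lower))
      upperEntry : reg s′ 4 ≡ lookup y i
      upperEntry = trans (cong (mem s) reg₁≡i)
        (trans (sym (lookup∘tabulate _ i)) (cong (λ z → lookup z i) upper))
      inv′ : Invariant s′ x y
      inv′ = record { Invariant inv }
      open Step s′ inv′ i reg₁≡i x≤o o≤y y≤B
        {k} {k ℕ.* 26 ℕ.+ 1} remaining≤ (guarantee-loop k)

  -- The approximation ratio and the running time.

  𝔼-payoff : ∀ μ → let e = 𝔼 (λ c → f (output c)) μ in 𝔼 payoff μ ≡ (e + e) + (e + e)
  𝔼-payoff (pure c)     = refl
  𝔼-payoff (coin p μ ν) = trans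
    (cong₂ (λ a b → p * a + (1# - p) * b) (𝔼-payoff μ) (𝔼-payoff ν))
    (solve 4 (λ p q a b →
      p :* ((a :+ a) :+ (a :+ a)) :+ q :* ((b :+ b) :+ (b :+ b)) :=
      ((p :* a :+ q :* b) :+ (p :* a :+ q :* b)) :+ ((p :* a :+ q :* b) :+ (p :* a :+ q :* b)))
      refl p (1# - p) _ _)

  start-invariant : Invariant (proj₂ (start doubleGreedy B)) (replicate n 0) B
  start-invariant = record
    { size = refl ; zeroᴺ = refl ; zeroᴿ = refl
    ; lower = slice-padding B ; upper = slice-contents B ; settled = λ _ () }

  approximation : All (0 ℕ.<_) B → NonNegative f →
    let μ = run f (52 ℕ.* (1 ℕ.+ (n ℕ.+ ∑log₂ B))) (start doubleGreedy B) in
    AllOutcomes Acceptable μ × ½ * maxBox B f ≤ 𝔼 (λ c → f (output c)) μ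
  approximation 0<B f≥0 with maxBox-attained B f
  ... | z , z≤B , fz≡max = subst (λ t → AllOutcomes Acceptable (outcomes t)) (sym time) (proj₁ final)
                         , subst₂ (λ m t → ½ * m ≤ value t) fz≡max (sym time) (x≤y+y⇒½*x≤y fz≤2e)
    where
    open ≤-Reasoning
    outcomes : ℕ → Dist Config
    outcomes t = run f t (start doubleGreedy B)
    value : ℕ → ℝ
    value t = 𝔼 (λ c → f (output c)) (outcomes t)
    k t : ℕ
    -- The initial measure: `n` coordinates to pass and `n + ∑log₂ B` halvings.
    k = n ℕ.+ (n ℕ.+ ∑log₂ B)
    -- The bound for the loop, plus the slack that fills it up to the stated time.
    t = k ℕ.* 26 ℕ.+ 1 ℕ.+ (26 ℕ.* ∑log₂ B ℕ.+ 51)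
    time : 52 ℕ.* (1 ℕ.+ (n ℕ.+ ∑log₂ B)) ≡ t
    time = arithmetic n (∑log₂ B)
      where
      arithmetic : ∀ n l → 52 ℕ.* (1 ℕ.+ (n ℕ.+ l)) ≡
                   (n ℕ.+ (n ℕ.+ l)) ℕ.* 26 ℕ.+ 1 ℕ.+ (26 ℕ.* l ℕ.+ 51)
      arithmetic = solve-∀
    final : AllOutcomes Acceptable (outcomes t) × Φ (replicate n 0) B z ≤ 𝔼 payoff (outcomes t)
    final = guarantee-loop k start-invariant (0≤ᵛ z) z≤B ≤ᵛ-refl
      (ℕ.≤-reflexive (cong (n ℕ.+_) (totalHalvings-initial 0<B))) .after (26 ℕ.* ∑log₂ B ℕ.+ 51)
    e : ℝ
    e = value t
    fz≤2e : f z ≤ e + e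
    fz≤2e = subst (_≤ e + e) (½*[x+x]≡x (f z)) (x≤y+y⇒½*x≤y (begin
      f z + f z                                      ≡⟨ +-identityˡ _ ⟨
      0# + (f z + f z)                               ≤⟨ +-monoˡ-≤ _
                                                          (+-nonNegative (f≥0 (replicate n 0)) (f≥0 B)) ⟩
      (f (replicate n 0) + f B) + (f z + f z)        ≤⟨ proj₂ final ⟩
      𝔼 payoff (outcomes t)                          ≡⟨ 𝔼-payoff (outcomes t) ⟩
      (e + e) + (e + e)                              ∎))

theorem5 : Σ[ P ∈ Program ] Σ[ C ∈ ℕ ]
    ((R : Reals) (let open Reals R) (let open Lattice R)
    (let open Probability R) (let open Machine R)
    (n : ℕ) (B : Vec ℕ n) → All (0 ℕ.<_) B →
    (f : Vec ℕ n → ℝ) → NonNegative f → DRSubmodular f →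
    (let μ = run f (C ℕ.* (1 ℕ.+ (n ℕ.+ ∑log₂ B))) (start P B)) →
    AllOutcomes (λ c → Halted c × output c ≤ᵛ B) μ ×
    ½ * maxBox B f ≤ 𝔼 (λ c → f (output c)) μ)
-- 52 is twice 26: an iteration takes at most 26 steps, and `n` enters the number of iterations
-- twice.
theorem5 = doubleGreedy , 52 , λ R n B 0<B f f≥0 dr →
  Analysis.approximation R B f dr 0<B f≥0
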